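{- For every integer $k\ge 4$, $\tilde{r}(P_3,P_3,C_{4k}) \le 6k+1$.
   Context: $P_m$ denotes the path and $C_m$ the cycle on $m$ vertices. The three-color online Ramsey game for graphs $G_1,G_2,G_3$ is played by Builder and Painter on an infinite vertex set with initially no edges. In each round Builder draws an edge between two currently nonadjacent vertices, and Painter immediately colors it red, blue or green. Builder wins once the colored graph contains a red copy of $G_1$, a blue copy of $G_2$, or a green copy of $G_3$. The online Ramsey number $\tilde{r}(G_1,G_2,G_3)$ is the minimum number of rounds within which Builder can guarantee a win against every strategy of Painter. -}

module Defs where

open import Data.Nat using (ℕ; zero; suc)
open import Data.Fin using (Fin; zero; suc; inject₁; fromℕ)
open import Data.List using (List; []; _∷_; map; _++_; allFin)
open import Data.List.Membership.Propositional using (_∈_)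
open import Data.List.Relation.Unary.All using (All)
open import Data.Product using (_×_; _,_; Σ; ∃)
open import Data.Sum using (_⊎_)
open import Function.Definitions using (Injective)
open import Relation.Binary.PropositionalEquality using (_≡_; _≢_)
open import Relation.Nullary using (¬_)

data Colour : Set where
  red blue green : Colour

-- A coloured graph on the (infinite) vertex set ℕ, given by its finite list
-- of coloured edges (u , v , c) (an undirected edge uv of colour c).
Board : Set
Board = List (ℕ × ℕ × Colour)

EdgeIn : Board → Colour → ℕ → ℕ → Set
EdgeIn H c u v = ((u , v , c) ∈ H) ⊎ ((v , u , c) ∈ H)

Adjacent : Board → ℕ → ℕ → Set
Adjacent H u v = ∃ λ c → EdgeIn H c u v

record Pattern : Set where
  constructor mkPattern
  field
    size  : ℕ
    edges : List (Fin size × Fin size)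

MonoCopy : Board → Colour → Pattern → Set
MonoCopy H c (mkPattern m es) =
  Σ (Fin m → ℕ) λ f → Injective _≡_ _≡_ f ×
    All (λ e → EdgeIn H c (f (Data.Product.proj₁ e)) (f (Data.Product.proj₂ e))) es

pathEdges : (n : ℕ) → List (Fin (suc n) × Fin (suc n))
pathEdges n = map (λ i → inject₁ i , suc i) (allFin n)

P : ℕ → Pattern
P zero    = mkPattern zero []
P (suc n) = mkPattern (suc n) (pathEdges n)

-- C_m : the cycle on m vertices (meaningful for m ≥ 3).
C : ℕ → Pattern
C zero    = mkPattern zero []
C (suc n) = mkPattern (suc n) ((fromℕ n , zero) ∷ pathEdges n)

Won : Pattern → Pattern → Pattern → Board → Set
Won G₁ G₂ G₃ H = MonoCopy H red G₁ ⊎ MonoCopy H blue G₂ ⊎ MonoCopy H green G₃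

-- BuilderWins G₁ G₂ G₃ H n : from position H, Builder can force a win within
-- at most n further rounds, whatever Painter does.  Either Builder has
-- already won, or Builder draws a new edge uv between distinct nonadjacent
-- vertices and, for every colour Painter chooses, can win within n-1 rounds.
data BuilderWins (G₁ G₂ G₃ : Pattern) : Board → ℕ → Set where
  done : ∀ {H n} → Won G₁ G₂ G₃ H → BuilderWins G₁ G₂ G₃ H n
  move : ∀ {H n} (u v : ℕ) → u ≢ v → ¬ Adjacent H u v →
         ((c : Colour) → BuilderWins G₁ G₂ G₃ ((u , v , c) ∷ H) n) →
         BuilderWins G₁ G₂ G₃ H (suc n)

OnlineRamseyLE : Pattern → Pattern → Pattern → ℕ → Set
OnlineRamseyLE G₁ G₂ G₃ N = BuilderWins G₁ G₂ G₃ [] N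

{-# OPTIONS --safe #-}
module Submission where

-- If Painter avoids a red and a blue P₃, a vertex meeting a red and a blue edge is saturated: all its further
-- edges are green, and so is an edge from a vertex with a red edge to one with a blue edge. Builder keeps a few
-- disjoint green paths, and prefers to extend a path at an end that already has a red or blue edge: either the path
-- grows or the end becomes saturated, and saturated ends can be joined directly or through a new vertex at will.
-- A red or blue edge serves two ends, so that two cycle vertices are gained per wasted edge; two half-used
-- ends are lost, whence 4k + 2k + 1 rounds. While no end is saturated Painter may answer mostly green, but
-- then the green paths grow so fast that for k ≥ 4 enough rounds remain to saturate an end at the very last vertex.

open import Defs
open import Data.Bool using (Bool; true; false; if_then_else_; _xor_)
open import Data.Empty using (⊥; ⊥-elim)
open import Data.Fin using (Fin; zero; suc; fromℕ; inject₁)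
open import Data.List using (List; []; _∷_; _++_; map; length; lookup)
open import Data.List.Membership.DecPropositional using () renaming (_∈?_ to member?)
open import Data.List.Membership.Propositional using (_∈_; _∉_)
open import Data.List.Membership.Propositional.Properties using (∈-map⁻; ∈-lookup)
open import Data.List.Properties using (++-assoc; ++-identityʳ)
open import Data.List.Relation.Binary.Permutation.Propositional using (_↭_; ↭-refl; ↭-sym; ↭-trans; ↭-reflexive; refl; prep; swap; trans; ↭⇒↭ₛ)
open import Data.List.Relation.Binary.Permutation.Propositional.Properties using (∈-resp-↭; ↭-length; ++-comm; ++⁺ˡ; ++⁺ʳ; shifts)
import Data.List.Relation.Binary.Permutation.Setoid.Properties as Permutationₛ
open import Data.List.Relation.Unary.All as All using (All; []; _∷_)
import Data.List.Relation.Unary.All.Properties as All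
open import Data.List.Relation.Unary.AllPairs using ([]; _∷_)
open import Data.List.Relation.Unary.Any as Any using (Any; here; there)
open import Data.List.Relation.Unary.Unique.Propositional using (Unique)
open import Data.Maybe using (Maybe; just; nothing; _>>=_)
open import Data.Nat using (ℕ; zero; suc; _+_; _*_; _≤_; _<_; _≟_; _<?_; _≤?_; z≤n; s≤s; s≤s⁻¹)
open import Data.Nat.Induction using (<-rec)
open import Data.Nat.Properties using (+-suc; +-identityʳ; m≤m+n; m≤n+m; ≤-trans; ≤-refl; <-irrefl; +-cancelˡ-≡; ≰⇒>; n≤1+n; suc-injective; ≤-antisym; ≤-reflexive; m≤n⇒m≤1+n; +-mono-≤; +-monoʳ-≤; *-monoˡ-≤; *-monoʳ-≤; *-assoc)
open import Data.Nat.Tactic.RingSolver using (solve-∀)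
open import Data.Product using (Σ; ∃; _×_; _,_; proj₁; map₂)
import Data.Product.Properties as Prod
open import Data.Sum using (_⊎_; inj₁; inj₂)
open import Data.Unit using (⊤; tt)
open import Function using (_∘_; id)
open import Function.Definitions using (Injective)
open import Relation.Binary using (DecidableEquality)
open import Relation.Binary.PropositionalEquality using (_≡_; _≢_; refl; sym; cong; subst; subst₂; setoid) renaming (trans to ≡-trans)
open import Relation.Nullary using (¬_; Dec; yes; no; does)
open import Relation.Nullary.Decidable using (_×-dec_; _⊎-dec_; ¬?; True; toWitness)

open import Data.List.Relation.Unary.Unique.DecPropositional _≟_ using (unique?)

-- Colours and edges on a board.

infix 4 _≟ᶜ_
_≟ᶜ_ : DecidableEquality Colour
red   ≟ᶜ red   = yes refl
red   ≟ᶜ blue  = no λ ()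
red   ≟ᶜ green = no λ ()
blue  ≟ᶜ red   = no λ ()
blue  ≟ᶜ blue  = yes refl
blue  ≟ᶜ green = no λ ()
green ≟ᶜ red   = no λ ()
green ≟ᶜ blue  = no λ ()
green ≟ᶜ green = yes refl

EdgeIn-sym : ∀ {H c u v} → EdgeIn H c u v → EdgeIn H c v u
EdgeIn-sym (inj₁ e) = inj₂ e
EdgeIn-sym (inj₂ e) = inj₁ e

EdgeIn-∷ : ∀ {H c u v e} → EdgeIn H c u v → EdgeIn (e ∷ H) c u v
EdgeIn-∷ (inj₁ e) = inj₁ (there e)
EdgeIn-∷ (inj₂ e) = inj₂ (there e)

EdgeIn? : ∀ H c u v → Dec (EdgeIn H c u v)
EdgeIn? H c u v = ((u , v , c) ∈? H) ⊎-dec ((v , u , c) ∈? H)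
  where
  open import Data.List.Membership.DecPropositional (Prod.≡-dec _≟_ (Prod.≡-dec _≟_ _≟ᶜ_)) using (_∈?_)

Adjacent? : ∀ H u v → Dec (Adjacent H u v)
Adjacent? H u v with EdgeIn? H red u v | EdgeIn? H blue u v | EdgeIn? H green u v
... | yes e | _     | _     = yes (red , e)
... | no _  | yes e | _     = yes (blue , e)
... | no _  | no _  | yes e = yes (green , e)
... | no ¬r | no ¬b | no ¬g = no λ { (red , e) → ¬r e ; (blue , e) → ¬b e ; (green , e) → ¬g e }

-- Monochromatic three-vertex paths, green paths and green cycles.

cherry : ∀ {H c a p q} → p ≢ a → q ≢ a → p ≢ q → EdgeIn H c a p → EdgeIn H c a q → MonoCopy H c (P 3)
cherry {a = a} {p} {q} p≢a q≢a p≢q ap aq = f , (λ {x} {y} → inj x y) , EdgeIn-sym ap ∷ aq ∷ []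
  where
  f : Fin 3 → ℕ
  f zero             = p
  f (suc zero)       = a
  f (suc (suc zero)) = q
  inj : ∀ x y → f x ≡ f y → x ≡ y
  inj zero             zero             _  = refl
  inj zero             (suc zero)       eq = ⊥-elim (p≢a eq)
  inj zero             (suc (suc zero)) eq = ⊥-elim (p≢q eq)
  inj (suc zero)       zero             eq = ⊥-elim (p≢a (sym eq))
  inj (suc zero)       (suc zero)       _  = refl
  inj (suc zero)       (suc (suc zero)) eq = ⊥-elim (q≢a (sym eq))
  inj (suc (suc zero)) zero             eq = ⊥-elim (p≢q (sym eq))
  inj (suc (suc zero)) (suc zero)       eq = ⊥-elim (q≢a eq)
  inj (suc (suc zero)) (suc (suc zero)) _  = refl

-- Distinctness is left out: `Placed` requires it once for the vertices of all pieces together,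
-- which also makes the pieces disjoint.
data Path (H : Board) : ℕ → ℕ → List ℕ → Set where
  [_] : ∀ a → Path H a a (a ∷ [])
  _∷_ : ∀ {a b c xs} → EdgeIn H green a b → Path H b c xs → Path H a c (a ∷ xs)

Path-weaken : ∀ {H e a b xs} → Path H a b xs → Path (e ∷ H) a b xs
Path-weaken [ a ]    = [ a ]
Path-weaken (e ∷ es) = EdgeIn-∷ e ∷ Path-weaken es

Path-++ : ∀ {H a b c d xs ys} → Path H a b xs → EdgeIn H green b c → Path H c d ys → Path H a d (xs ++ ys)
Path-++ [ a ]    e q = e ∷ q
Path-++ (f ∷ p) e q = f ∷ Path-++ p e q

Path-reverse : ∀ {H a b xs} → Path H a b xs → ∃ λ ys → Path H b a ys × xs ↭ ys
Path-reverse [ a ] = _ , [ a ] , ↭-refl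
Path-reverse {a = a} (e ∷ p) with ys , q , xs↭ys ← Path-reverse p =
  ys ++ a ∷ [] , Path-++ q (EdgeIn-sym e) [ a ] , ↭-trans (prep a xs↭ys) (++-comm (a ∷ []) ys)

Path-head : ∀ {H a b x xs} → Path H a b (x ∷ xs) → x ≡ a
Path-head [ _ ]   = refl
Path-head (_ ∷ _) = refl

Path-step : ∀ {H a b x xs} → Path H a b (x ∷ xs) → ∀ i → EdgeIn H green (lookup (x ∷ xs) (inject₁ i)) (lookup xs i)
Path-step (e ∷ p@([ _ ]))   zero    = e
Path-step (e ∷ p@(_ ∷ _)) zero    = e
Path-step (e ∷ p@([ _ ]))   (suc ())
Path-step (e ∷ p@(_ ∷ _)) (suc i) = Path-step p i

Path-last : ∀ {H a b x xs} → Path H a b (x ∷ xs) → lookup (x ∷ xs) (fromℕ (length xs)) ≡ b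
Path-last [ _ ]                = refl
Path-last (_ ∷ p@([ _ ]))   = Path-last p
Path-last (_ ∷ p@(_ ∷ _)) = Path-last p

lookup-injective : ∀ {xs : List ℕ} → Unique xs → ∀ i j → lookup xs i ≡ lookup xs j → i ≡ j
lookup-injective (x ∷ u) zero    zero    _  = refl
lookup-injective (x ∷ u) zero    (suc j) eq = ⊥-elim (All.lookup x (∈-lookup j) eq)
lookup-injective (x ∷ u) (suc i) zero    eq = ⊥-elim (All.lookup x (∈-lookup i) (sym eq))
lookup-injective (x ∷ u) (suc i) (suc j) eq = cong suc (lookup-injective u i j eq)

cycle : ∀ {H a b xs} → Path H a b xs → Unique xs → EdgeIn H green b a → MonoCopy H green (C (length xs))
cycle {xs = x ∷ xs} p u e = lookup (x ∷ xs) , (λ {i} {j} → lookup-injective u i j) , subst₂ (EdgeIn _ green) (sym (Path-last p)) (sym (Path-head p)) e ∷ All.map⁺ (All.tabulate⁺ (Path-step p))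

-- Arrangements of disjoint green paths.

data Shape : Set where
  one : ℕ → Shape
  seg : ℕ → ℕ → Shape

Realises : Board → (ℕ → ℕ) → Shape → List ℕ → Set
Realises H ρ (one a)   xs = xs ≡ ρ a ∷ []
Realises H ρ (seg a b) xs = Path H (ρ a) (ρ b) xs

data Layout (H : Board) (ρ : ℕ → ℕ) : List Shape → List ℕ → Set where
  []  : Layout H ρ [] []
  _∷_ : ∀ {p ps xs ys} → Realises H ρ p xs → Layout H ρ ps ys → Layout H ρ (p ∷ ps) (xs ++ ys)

Realises-weaken : ∀ {H ρ e} p {xs} → Realises H ρ p xs → Realises (e ∷ H) ρ p xs
Realises-weaken (one a)   p = p
Realises-weaken (seg a b) p = Path-weaken p

Layout-weaken : ∀ {H ρ e ps ys} → Layout H ρ ps ys → Layout (e ∷ H) ρ ps ys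
Layout-weaken []                 = []
Layout-weaken (_∷_ {p = p} x xs) = Realises-weaken p x ∷ Layout-weaken xs

-- Reversing and joining paths permutes the vertex list. This is harmless, since only membership,
-- distinctness and length matter later.
Arranges : Board → (ℕ → ℕ) → List Shape → List ℕ → Set
Arranges H ρ ps ys = ∃ λ zs → Layout H ρ ps zs × ys ↭ zs

infix 4 _⇒_
_⇒_ : List Shape → List Shape → Set
ps ⇒ qs = ∀ {H ρ ys} → Layout H ρ ps ys → Arranges H ρ qs ys

⇒-refl : ∀ {ps} → ps ⇒ ps
⇒-refl l = _ , l , ↭-refl

⇒-trans : ∀ {ps qs ss} → ps ⇒ qs → qs ⇒ ss → ps ⇒ ss
⇒-trans f g l with _ , l′ , σ ← f l with _ , l″ , τ ← g l′ = _ , l″ , ↭-trans σ τ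

⇒-prep : ∀ p {ps qs} → ps ⇒ qs → p ∷ ps ⇒ p ∷ qs
⇒-prep p f (_∷_ {xs = xs} x l) with _ , l′ , σ ← f l = _ , x ∷ l′ , ++⁺ˡ xs σ

⇒-swap : ∀ {p q ps} → p ∷ q ∷ ps ⇒ q ∷ p ∷ ps
⇒-swap (_∷_ {xs = xs} x (_∷_ {xs = ys} y l)) = _ , y ∷ (x ∷ l) , shifts xs ys

⇒-flip : ∀ {a b ps} → seg a b ∷ ps ⇒ seg b a ∷ ps
⇒-flip (_∷_ {ys = ys} x l) with _ , x′ , σ ← Path-reverse x = _ , x′ ∷ l , ++⁺ʳ ys σ

⇒-unit : ∀ {a ps} → one a ∷ ps ⇒ seg a a ∷ ps
⇒-unit (refl ∷ l) = _ , [ _ ] ∷ l , ↭-refl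

↭⇒⇒ : ∀ {ps qs} → ps ↭ qs → ps ⇒ qs
↭⇒⇒ refl          = ⇒-refl
↭⇒⇒ (prep p σ)    = ⇒-prep p (↭⇒⇒ σ)
↭⇒⇒ (swap p q σ)  = ⇒-trans ⇒-swap (⇒-prep q (⇒-prep p (↭⇒⇒ σ)))
↭⇒⇒ (trans σ τ)   = ⇒-trans (↭⇒⇒ σ) (↭⇒⇒ τ)

Front : ℕ → List Shape → Set
Front a ps = Σ ℕ λ o → Σ (List Shape) λ rest → ps ⇒ seg o a ∷ rest

Front-∷ : ∀ {a} p {ps} → Front a ps → Front a (p ∷ ps)
Front-∷ p (o , rest , f) = o , p ∷ rest , ⇒-trans (⇒-prep p f) ⇒-swap

front : ∀ a ps → Maybe (Front a ps)
front a [] = nothing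
front a (one b ∷ ps) with a ≟ b
... | yes refl = just (a , ps , ⇒-unit)
... | no _     = front a ps >>= just ∘ Front-∷ (one b)
front a (seg b c ∷ ps) with a ≟ b | a ≟ c
... | yes refl | _        = just (c , ps , ⇒-flip)
... | no _     | yes refl = just (b , ps , ⇒-refl)
... | no _     | no _     = front a ps >>= just ∘ Front-∷ (seg b c)

Joined : ℕ → ℕ → List Shape → Set
Joined a b ps = Σ (List Shape) λ qs →
  ∀ {H ρ ys} → EdgeIn H green (ρ a) (ρ b) → Layout H ρ ps ys → Arranges H ρ qs ys

joined : ∀ {a b ps o rest} → ps ⇒ seg o a ∷ rest → Front b rest → Joined a b ps
joined {o = o} f (o′ , rest′ , g) = seg o o′ ∷ rest′ , λ e l → go e (⇒-trans f (⇒-trans (⇒-prep _ g) (⇒-prep _ ⇒-flip)) l)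
  where
  go : ∀ {H ρ ys a b} → EdgeIn H green (ρ a) (ρ b) → Arranges H ρ (seg o a ∷ seg b o′ ∷ rest′) ys → Arranges H ρ (seg o o′ ∷ rest′) ys
  go e (_ , (_∷_ {xs = xs} x (_∷_ {xs = ys} {ys = zs} y l)) , σ) =
    _ , Path-++ x e y ∷ l , ↭-trans σ (↭-reflexive (sym (++-assoc xs ys zs)))

-- The end `b` is sought only among the pieces left once the one ending in `a` is removed, so a join
-- never closes a path into a cycle; that is left to `closed`.
join : ∀ a b ps → Maybe (Joined a b ps)
join a b ps = front a ps >>= λ { (o , rest , f) → front b rest >>= just ∘ joined f }

infix 4 _≈_
_≈_ : Shape → Shape → Set
one a   ≈ one b   = a ≡ b
seg a b ≈ seg c d = (a ≡ c × b ≡ d) ⊎ (a ≡ d × b ≡ c)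
_       ≈ _       = ⊥

_≈?_ : ∀ p q → Dec (p ≈ q)
one a   ≈? one b   = a ≟ b
one _   ≈? seg _ _ = no λ ()
seg _ _ ≈? one _   = no λ ()
seg a b ≈? seg c d = ((a ≟ c) ×-dec (b ≟ d)) ⊎-dec ((a ≟ d) ×-dec (b ≟ c))

≈⇒⇒ : ∀ {p q ps} → p ≈ q → p ∷ ps ⇒ q ∷ ps
≈⇒⇒ {one _}   {one _}   refl                 = ⇒-refl
≈⇒⇒ {seg _ _} {seg _ _} (inj₁ (refl , refl)) = ⇒-refl
≈⇒⇒ {seg _ _} {seg _ _} (inj₂ (refl , refl)) = ⇒-flip

extract : ∀ q ps → Maybe (Σ (List Shape) λ rest → ps ⇒ q ∷ rest)
extract q [] = nothing
extract q (p ∷ ps) with p ≈? q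
... | yes p≈q = just (ps , ≈⇒⇒ p≈q)
... | no _    = extract q ps >>= λ { (rest , f) → just (p ∷ rest , ⇒-trans (⇒-prep p f) ⇒-swap) }

arrange : ∀ qs ps → Maybe (Σ (List Shape) λ rest → ps ⇒ qs ++ rest)
arrange []       ps = just (ps , ⇒-refl)
arrange (q ∷ qs) ps = extract q ps >>= λ { (rest , f) → arrange qs rest >>= λ { (rest′ , g) → just (rest′ , ⇒-trans f (⇒-prep q g)) } }

-- ρ interprets names as vertices; the names ≥ m are a reservoir of unused vertices.
record Placed (L : ℕ) (H : Board) (ρ : ℕ → ℕ) (m : ℕ) (ps : List Shape) (r : ℕ) : Set where
  constructor placed
  field
    {vertices} : List ℕ
    layout     : Layout H ρ ps vertices
    unique     : Unique vertices
    unused     : ∀ i → m ≤ i → ρ i ∉ vertices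
    total      : length vertices + r ≡ L

module _ {L : ℕ} {H : Board} {ρ : ℕ → ℕ} {m : ℕ} where

  rearrange : ∀ {ps qs r} → (∀ {ys} → Layout H ρ ps ys → Arranges H ρ qs ys) → Placed L H ρ m ps r → Placed L H ρ m qs r
  rearrange f (placed l u v t) with _ , l′ , σ ← f l =
    placed l′ (Permutationₛ.Unique-resp-↭ (setoid ℕ) (↭⇒↭ₛ σ) u) (λ i m≤i → v i m≤i ∘ ∈-resp-↭ (↭-sym σ))
      (≡-trans (cong (_+ _) (sym (↭-length σ))) t)

  toss : ∀ {a ps r} → Placed L H ρ m (one a ∷ ps) r → Placed L H ρ m ps (suc r)
  toss (placed (refl ∷ l) (_ ∷ u) v t) = placed l u (λ i m≤i → v i m≤i ∘ there) (≡-trans (+-suc _ _) t)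

  addNew : Injective _≡_ _≡_ ρ → ∀ {ps r} → Placed L H ρ m ps (suc r) → Placed L H ρ (suc m) (one m ∷ ps) r
  addNew inj (placed {ys} l u v t) = placed (refl ∷ l) (All.tabulate (λ {x} x∈ eq → v m ≤-refl (subst (_∈ ys) (sym eq) x∈)) ∷ u)
    (λ { i m<i (here eq) → <-irrefl (sym (inj eq)) m<i ; i m<i (there i∈) → v i (≤-trans (n≤1+n m) m<i) i∈ })
    (≡-trans (sym (+-suc _ _)) t)

  Placed-weaken : ∀ {e ps r} → Placed L H ρ m ps r → Placed L (e ∷ H) ρ m ps r
  Placed-weaken (placed l u v t) = placed (Layout-weaken l) u v t

tossAll : ∀ ps → Maybe (Σ (ℕ → ℕ) λ f → ∀ {L H ρ m qs r} → Placed L H ρ m (ps ++ qs) r → Placed L H ρ m qs (f r))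
tossAll []             = just (id , id)
tossAll (one a ∷ ps)   = tossAll ps >>= λ { (f , g) → just (f ∘ suc , g ∘ toss) }
tossAll (seg _ _ ∷ ps) = nothing

Embedded : List Shape → List Shape → Set
Embedded qs ps = Σ (ℕ → ℕ) λ f → ∀ {L H ρ m r} → Placed L H ρ m ps r → Placed L H ρ m qs (f r)

embed : ∀ qs ps → Maybe (Embedded qs ps)
embed qs ps = arrange qs ps >>= λ { (rest , f) → tossAll rest >>= λ { (g , h) →
  just (g , λ p → h (rearrange (⇒-trans f (↭⇒⇒ (++-comm qs rest))) p)) } }

-- Known edges and the symmetry of red and blue.

-- half c a xs: a has a c-coloured edge whose other end is not (the vertex named) i, for any i ∉ xs.
data Fact : Set where
  half : Colour → ℕ → List ℕ → Fact
  link : ℕ → ℕ → Fact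

-- The Boolean exchanges red and blue, so that a position and its mirror image share one strategy.
hue : Bool → Colour → Colour
hue false c     = c
hue true  red   = blue
hue true  blue  = red
hue true  green = green

hue-involutive : ∀ s c → hue s (hue s c) ≡ c
hue-involutive false c     = refl
hue-involutive true  red   = refl
hue-involutive true  blue  = refl
hue-involutive true  green = refl

hue-green : ∀ s → hue s green ≡ green
hue-green false = refl
hue-green true  = refl

hue-xor : ∀ s t c → hue (s xor t) c ≡ hue s (hue t c)
hue-xor false t     c     = refl
hue-xor true  false c     = refl
hue-xor true  true  red   = refl
hue-xor true  true  blue  = refl
hue-xor true  true  green = refl

Holds : Board → (ℕ → ℕ) → Bool → Fact → Set
Holds H ρ s (half c a xs) = ∃ λ p → EdgeIn H (hue s c) (ρ a) p × p ≢ ρ a × (∀ i → i ∉ xs → p ≢ ρ i)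
Holds H ρ s (link a b)    = EdgeIn H green (ρ a) (ρ b)

Holds-weaken : ∀ {H ρ s e} f → Holds H ρ s f → Holds (e ∷ H) ρ s f
Holds-weaken (half _ _ _) (p , e , h) = p , EdgeIn-∷ e , h
Holds-weaken (link _ _)   e           = EdgeIn-∷ e

-- A red or blue edge is kept as two independent halves, since either end may later be given up or
-- buried inside a path.
paint : Colour → ℕ → ℕ → List Fact
paint green a b = link a b ∷ []
paint c     a b = half c a (b ∷ []) ∷ half c b (a ∷ []) ∷ []

half-holds : ∀ c t {a b H ρ} → Injective _≡_ _≡_ ρ → b ≢ a → EdgeIn H (hue t c) (ρ a) (ρ b) → Holds H ρ t (half c a (b ∷ []))
half-holds c t inj b≢a e = _ , e , b≢a ∘ inj , λ i i∉ eq → i∉ (here (sym (inj eq)))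

paint-holds : ∀ {c a b H ρ t} → Injective _≡_ _≡_ ρ → a ≢ b → EdgeIn H (hue t c) (ρ a) (ρ b) → All (Holds H ρ t) (paint c a b)
paint-holds {green} {t = t} inj a≢b e = subst (λ c → EdgeIn _ c _ _) (hue-green t) e ∷ []
paint-holds {red}   {t = t} inj a≢b e = half-holds red t inj (a≢b ∘ sym) e ∷ half-holds red t inj a≢b (EdgeIn-sym e) ∷ []
paint-holds {blue}  {t = t} inj a≢b e = half-holds blue t inj (a≢b ∘ sym) e ∷ half-holds blue t inj a≢b (EdgeIn-sym e) ∷ []

_∈?_ : (x : ℕ) (xs : List ℕ) → Dec (x ∈ xs)
_∈?_ = member? _≟_

-- If the other endpoint is not excepted, the known edge at `x` differs from `ab`, so giving `ab`
-- the colour `c` creates a monochromatic P₃ centred at `x`.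
Blocks : Colour → ℕ → ℕ → Fact → Set
Blocks c a b (half d x xs) = c ≡ d × (x ≡ a × b ∉ xs ⊎ x ≡ b × a ∉ xs)
Blocks c a b (link _ _)    = ⊥

blocks? : ∀ c a b f → Dec (Blocks c a b f)
blocks? c a b (half d x xs) = (c ≟ᶜ d) ×-dec (((x ≟ a) ×-dec ¬? (b ∈? xs)) ⊎-dec ((x ≟ b) ×-dec ¬? (a ∈? xs)))
blocks? c a b (link _ _)    = no λ ()

clash? : ∀ c a b es → Dec (Any (Blocks c a b) es)
clash? c a b = Any.any? (blocks? c a b)

Linked : ℕ → ℕ → Fact → Set
Linked a b (half _ _ _) = ⊥
Linked a b (link c d)   = a ≡ c × b ≡ d ⊎ a ≡ d × b ≡ c

linked? : ∀ a b f → Dec (Linked a b f)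
linked? a b (half _ _ _) = no λ ()
linked? a b (link c d)   = ((a ≟ c) ×-dec (b ≟ d)) ⊎-dec ((a ≟ d) ×-dec (b ≟ c))

linked-holds : ∀ {a b es H ρ s} → Any (Linked a b) es → All (Holds H ρ s) es → EdgeIn H green (ρ a) (ρ b)
linked-holds {a} {b} {es} {H} {ρ} {s} l hs = go (All.lookupAny hs l)
  where
  go : ∀ {f} → Holds H ρ s f × Linked a b f → EdgeIn H green (ρ a) (ρ b)
  go {link _ _} (e , inj₁ (refl , refl)) = e
  go {link _ _} (e , inj₂ (refl , refl)) = EdgeIn-sym e

-- Renaming a position.

rename : List ℕ → ℕ → ℕ → ℕ
rename []       m i       = m + i
rename (x ∷ xs) m zero    = x
rename (x ∷ xs) m (suc i) = rename xs m i

renameShape : List ℕ → ℕ → Shape → Shape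
renameShape σ m (one a)   = one (rename σ m a)
renameShape σ m (seg a b) = seg (rename σ m a) (rename σ m b)

rename-≢ : ∀ σ {m j} → j < m → j ∉ σ → ∀ i → j ≢ rename σ m i
rename-≢ []      {m} j<m j∉ i       refl = <-irrefl refl (≤-trans j<m (m≤m+n m i))
rename-≢ (x ∷ σ) j<m j∉ zero    eq   = j∉ (here eq)
rename-≢ (x ∷ σ) j<m j∉ (suc i) eq   = rename-≢ σ j<m (j∉ ∘ there) i eq

rename-injective : ∀ {σ m} → Unique σ → All (_< m) σ → ∀ {i j} → rename σ m i ≡ rename σ m j → i ≡ j
rename-injective {[]}    {m} _       _        {i}     {j}     eq = +-cancelˡ-≡ m i j eq
rename-injective {x ∷ σ}     _       _        {zero}  {zero}  _  = refl
rename-injective {x ∷ σ}     (x∉ ∷ _) (x< ∷ _) {zero}  {suc j} eq = ⊥-elim (rename-≢ σ x< (λ x∈ → All.lookup x∉ x∈ refl) j eq)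
rename-injective {x ∷ σ}     (x∉ ∷ _) (x< ∷ _) {suc i} {zero}  eq = ⊥-elim (rename-≢ σ x< (λ x∈ → All.lookup x∉ x∈ refl) i (sym eq))
rename-injective {x ∷ σ}     (_ ∷ u) (_ ∷ b)  {suc i} {suc j} eq = cong suc (rename-injective u b eq)

rename-unused : ∀ σ m i → length σ ≤ i → m ≤ rename σ m i
rename-unused []      m i       _       = m≤m+n m i
rename-unused (x ∷ σ) m (suc i) (s≤s l) = rename-unused σ m i l

Layout-rename : ∀ {H ρ} σ m qs {ys} → Layout H ρ (map (renameShape σ m) qs) ys → Layout H (ρ ∘ rename σ m) qs ys
Layout-rename σ m []             []      = []
Layout-rename σ m (one a ∷ qs)   (x ∷ l) = x ∷ Layout-rename σ m qs l
Layout-rename σ m (seg a b ∷ qs) (x ∷ l) = x ∷ Layout-rename σ m qs l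

record Position : Set where
  constructor position
  field
    names  : ℕ
    shapes : List Shape
    facts  : List Fact
open Position

-- A fact may be weakened by adding exceptions. An exception whose name is forgotten by `σ`
-- vanishes, as no new name denotes that vertex; `j < m` rules out reservoir names, which survive
-- the renaming.
Supplies : Bool → List ℕ → ℕ → Fact → Fact → Set
Supplies s σ m (half c a xs) (half d b ys) =
  d ≡ hue s c × b ≡ rename σ m a × All (λ j → j ∈ map (rename σ m) xs ⊎ j < m × j ∉ σ) ys
Supplies s σ m _ _ = ⊥

supplies? : ∀ s σ m f g → Dec (Supplies s σ m f g)
supplies? s σ m (half c a xs) (half d b ys) =
  (d ≟ᶜ hue s c) ×-dec ((b ≟ rename σ m a) ×-dec
    All.all? (λ j → (j ∈? map (rename σ m) xs) ⊎-dec ((j <? m) ×-dec ¬? (j ∈? σ))) ys)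
supplies? s σ m (half _ _ _) (link _ _)   = no λ ()
supplies? s σ m (link _ _)   (half _ _ _) = no λ ()
supplies? s σ m (link _ _)   (link _ _)   = no λ ()

Renames : Position → Bool → List ℕ → ℕ → List Fact → Set
Renames q s σ m es =
  length σ ≡ names q × Unique σ × All (_< m) σ × All (λ f → Any (Supplies s σ m f) es) (facts q)

renames? : ∀ q s σ m es → Dec (Renames q s σ m es)
renames? q s σ m es = (length σ ≟ names q) ×-dec (unique? σ ×-dec
  (All.all? (_<? m) σ ×-dec All.all? (λ f → Any.any? (supplies? s σ m f) es) (facts q)))

Supplies-Holds : ∀ {H ρ s t σ m} → Unique σ → All (_< m) σ → Injective _≡_ _≡_ ρ →
  ∀ f g → Supplies t σ m f g → Holds H ρ s g → Holds H (ρ ∘ rename σ m) (s xor t) f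
Supplies-Holds {s = s} {t} {σ} {m} u b inj (half c a xs) (half d _ ys) (refl , refl , cov) (p , e , p≢a , p≢) =
  p , subst (λ h → EdgeIn _ h _ p) (sym (hue-xor s t c)) e , p≢a , λ i i∉ → p≢ (rename σ m i) (λ j∈ → avoid i i∉ (All.lookup cov j∈))
  where
  avoid : ∀ i → i ∉ xs → ¬ (rename σ m i ∈ map (rename σ m) xs ⊎ rename σ m i < m × rename σ m i ∉ σ)
  avoid i i∉ (inj₁ j∈) with k , k∈ , eq ← ∈-map⁻ (rename σ m) j∈ = i∉ (subst (_∈ xs) (sym (rename-injective u b eq)) k∈)
  avoid i i∉ (inj₂ (j<m , j∉)) = rename-≢ σ j<m j∉ i refl

-- On a concrete position the search evaluates, so a premise of this form reduces to a claim about
-- the resulting position; a failed search leaves `⊥`.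
OnJust : ∀ {a} {A : Set a} → Maybe A → (A → Set) → Set
OnJust (just x) f = f x
OnJust nothing  f = ⊥

BuilderWins-suc : ∀ {G₁ G₂ G₃ H n} → BuilderWins G₁ G₂ G₃ H n → BuilderWins G₁ G₂ G₃ H (suc n)
BuilderWins-suc (done w)           = done w
BuilderWins-suc (move u v u≢v ¬a k) = move u v u≢v ¬a (λ c → BuilderWins-suc (k c))

-- Arithmetic of the round bounds.

-- Once `n` is unrolled, both sides of a bound start with numerals: `i` is removed from both, and
-- `k` is surplus thrown away.
cancel : ∀ i k {x y} → i + (k + x) ≤ i + y → x ≤ y
cancel zero    k h = ≤-trans (m≤n+m _ k) h
cancel (suc i) k h = cancel i k (s≤s⁻¹ h)

-- The extra 1 on the right absorbs parity: an odd lower bound on 2n is rounded up.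
atLeast : ∀ j n {x} → j * 2 + x ≤ suc (n * 2) → j ≤ n
atLeast zero    n       _        = z≤n
atLeast (suc j) zero    (s≤s ())
atLeast (suc j) (suc n) h        = s≤s (atLeast j n (s≤s⁻¹ (s≤s⁻¹ h)))

atLeast³ : ∀ j n {x} → j * 3 + x ≤ 2 + n * 3 → j ≤ n
atLeast³ zero    n       _              = z≤n
atLeast³ (suc j) zero    (s≤s (s≤s ()))
atLeast³ (suc j) (suc n) h              = s≤s (atLeast³ j n (s≤s⁻¹ (s≤s⁻¹ (s≤s⁻¹ h))))

unroll : ∀ {j n} → j ≤ n → ∃ λ n′ → n ≡ j + n′
unroll z≤n     = _ , refl
unroll (s≤s l) = map₂ (cong suc) (unroll l)

earlier : ∀ j {n} → n < suc j + n
earlier j = s≤s (m≤n+m _ j)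

double : ∀ {m n} → m ≤ n → m * 2 ≤ n * 2
double = *-monoˡ-≤ 2

triple : ∀ {m n} → m ≤ n → m * 3 ≤ n * 3
triple = *-monoˡ-≤ 3

4j≤6j : ∀ j → j * 4 ≤ j * 6
4j≤6j j = *-monoʳ-≤ j (m≤m+n 4 2)

12j≤12j : ∀ j → j * 4 * 3 ≤ j * 6 * 2
12j≤12j j = ≤-reflexive (≡-trans (*-assoc j 4 3) (sym (*-assoc j 6 2)))

16j≤18j : ∀ j → j * 4 * 4 ≤ j * 6 * 3
16j≤18j j = subst₂ _≤_ (sym (*-assoc j 4 4)) (sym (*-assoc j 6 3)) (*-monoʳ-≤ j (m≤m+n 16 2))

-- Builder's moves and reductions between positions.

module Strategy (L : ℕ) where

  Win : Board → ℕ → Set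
  Win = BuilderWins (P 3) (P 3) (C L)

  record Realised (p : Position) (r : ℕ) (H : Board) (ρ : ℕ → ℕ) (s : Bool) : Set where
    constructor realised
    field
      injective : Injective _≡_ _≡_ ρ
      holds     : All (Holds H ρ s) (facts p)
      place     : Placed L H ρ (names p) (shapes p) r

  -- r is the number of vertices missing from the pieces, n the number of rounds left.
  record Wins (p : Position) (r n : ℕ) : Set where
    constructor wins
    field
      run : ∀ {H ρ s} → Realised p r H ρ s → Win H n
  open Wins

  -- A colour that clashes loses at once, so that tt is a complete reply to it.
  Answer : Colour → ℕ → ℕ → Position → ℕ → ℕ → Set
  Answer c a b (position m ps es) r n =
    if does (clash? c a b es) then ⊤ else Wins (position m ps (paint c a b ++ es)) r n

  won : ∀ {H c} s → c ≢ green → MonoCopy H (hue s c) (P 3) → ∀ {n} → Win H n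
  won {c = red}   false _   w = done (inj₁ w)
  won {c = red}   true  _   w = done (inj₂ (inj₁ w))
  won {c = blue}  false _   w = done (inj₂ (inj₁ w))
  won {c = blue}  true  _   w = done (inj₁ w)
  won {c = green} _     c≢g _ = ⊥-elim (c≢g refl)

  module _ {m : ℕ} {ps : List Shape} {es : List Fact} {r n : ℕ} where
    private pos = position m ps es

    clash-wins : ∀ {c a b H ρ s} → c ≢ green → a ≢ b → Any (Blocks c a b) es → Realised pos r H ρ s → EdgeIn H (hue s c) (ρ a) (ρ b) → Win H n
    clash-wins {c} {a} {b} {H} {ρ} {s} c≢g a≢b bl (realised inj hs _) e = go (All.lookupAny hs bl)
      where
      go : ∀ {f} → Holds H ρ s f × Blocks c a b f → Win H n
      go {half _ _ _} ((p , e′ , p≢ , p≢′) , refl , inj₁ (refl , b∉)) = won s c≢g (cherry p≢ (a≢b ∘ sym ∘ inj) (p≢′ b b∉) e′ e)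
      go {half _ _ _} ((p , e′ , p≢ , p≢′) , refl , inj₂ (refl , a∉)) = won s c≢g (cherry p≢ (a≢b ∘ inj) (p≢′ a a∉) e′ (EdgeIn-sym e))

    continue : ∀ {c a b H ρ s} → a ≢ b → Wins (position m ps (paint c a b ++ es)) r n → Realised pos r H ρ s → EdgeIn H (hue s c) (ρ a) (ρ b) → Win H n
    continue a≢b k (realised inj hs pl) e = run k (realised inj (All.++⁺ (paint-holds inj a≢b e) hs) pl)

    answer : ∀ {c a b H ρ s} → c ≢ green → a ≢ b → Answer c a b pos r n → Realised pos r H ρ s → EdgeIn H (hue s c) (ρ a) (ρ b) → Win H n
    answer {c} {a} {b} c≢g a≢b k R e with clash? c a b es
    ... | yes bl = clash-wins c≢g a≢b bl R e
    ... | no _   = continue a≢b k R e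

    -- If the edge is already on the board, its colour plays the role of Painter's answer and no round is spent.
    draw : ∀ a b {_ : True (¬? (a ≟ b))} → Wins (position m ps (link a b ∷ es)) r n →
      Answer red a b pos r n → Answer blue a b pos r n → Wins pos r (suc n)
    draw a b {a≢b?} kg kr kb = wins go
      where
      a≢b = toWitness a≢b?
      reply : ∀ {H ρ s} → Realised pos r H ρ s → ∀ c → EdgeIn H (hue s c) (ρ a) (ρ b) → Win H n
      reply R red   = answer (λ ()) a≢b kr R
      reply R blue  = answer (λ ()) a≢b kb R
      reply R green = continue {c = green} a≢b kg R
      respond : ∀ {H ρ s} → Realised pos r H ρ s → ∀ c → EdgeIn H c (ρ a) (ρ b) → Win H n
      respond {s = s} R c e = reply R (hue s c) (subst (λ d → EdgeIn _ d _ _) (sym (hue-involutive s c)) e)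
      go : ∀ {H ρ s} → Realised pos r H ρ s → Win H (suc n)
      go {H} {ρ} {s} R@(realised inj hs pl) with Adjacent? H (ρ a) (ρ b)
      ... | yes (c , e) = BuilderWins-suc (respond R c e)
      ... | no ¬adj     = move (ρ a) (ρ b) (a≢b ∘ inj) ¬adj λ c →
        respond {s = s} (realised inj (All.map (Holds-weaken _) hs) (Placed-weaken pl)) c (inj₁ (here refl))

    new : Wins (position (suc m) (one m ∷ ps) es) r n → Wins pos (suc r) n
    new k = wins λ { (realised inj hs pl) → run k (realised inj hs (addNew inj pl)) }

    merge : ∀ a b {_ : True (Any.any? (linked? a b) es)} → OnJust (join a b ps) (λ j → Wins (position m (proj₁ j) es) r n) → Wins pos r n
    merge a b {l} k with join a b ps
    ... | just (_ , f) = wins λ { (realised inj hs pl) → run k (realised inj hs (rearrange (f (linked-holds (toWitness l) hs)) pl)) }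

    -- Reduces to position q, renamed by σ and (if s) with red and blue exchanged; spare single vertices are given up.
    use : ∀ q s σ {_ : True (renames? q s σ m es)} →
      OnJust (embed (map (renameShape σ m) (shapes q)) ps) (λ e → Wins q (proj₁ e r) n) → Wins pos r n
    use q s σ {ok} k with embed (map (renameShape σ m) (shapes q)) ps | toWitness ok
    ... | just (_ , f) | (len , u , b , sup) = wins λ { (realised inj hs pl) →
            run k (realised (rename-injective u b ∘ inj) (All.map (λ {g} → supplied inj hs g) sup) (replace (f pl))) }
      where
      supplied : ∀ {H ρ t} → Injective _≡_ _≡_ ρ → All (Holds H ρ t) es → ∀ g → Any (Supplies s σ m g) es → Holds H (ρ ∘ rename σ m) (t xor s) g
      supplied inj hs g any with h , sp ← All.lookupAny hs any = Supplies-Holds u b inj g _ sp h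
      replace : ∀ {H ρ r} → Placed L H ρ m (map (renameShape σ m) (shapes q)) r → Placed L H (ρ ∘ rename σ m) (names q) (shapes q) r
      replace (placed l un v t) = placed (Layout-rename σ m (shapes q) l) un
        (λ i q≤i → v (rename σ m i) (rename-unused σ m i (subst (_≤ i) (sym len) q≤i))) t

  closed : ∀ {m a b es n} {_ : True (Any.any? (linked? a b) es)} → Wins (position m (seg a b ∷ []) es) 0 n
  closed {m} {a} {b} {es} {n} {l} = wins λ { (realised inj hs (placed (_∷_ {xs = xs} p []) u v t)) →
    done (inj₂ (inj₂ (subst (λ k → MonoCopy _ green (C k)) (≡-trans (sym (+-identityʳ _)) t)
      (subst (λ zs → MonoCopy _ green (C (length zs))) (sym (++-identityʳ xs))
        (cycle p (subst Unique (++-identityʳ xs) u) (EdgeIn-sym (linked-holds (toWitness l) hs))))))) }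

  module _ {m : ℕ} {ps : List Shape} {es : List Fact} {r n : ℕ} where
    private pos = position m ps es

    connect : ∀ a b {_ : True (¬? (a ≟ b))} {_ : True (Any.any? (linked? a b) (link a b ∷ es))} →
      OnJust (join a b ps) (λ j → Wins (position m (proj₁ j) (link a b ∷ es)) r n) →
      Answer red a b pos r n → Answer blue a b pos r n → Wins pos r (suc n)
    connect a b {a≢b} {l} kg = draw a b {a≢b} (merge a b {l} kg)

    -- If red and blue both lose for Painter, the two implicit answers reduce to `⊤` and are filled
    -- in by eta, so only the green continuation is written.
    force : ∀ a b {_ : True (¬? (a ≟ b))} {_ : True (Any.any? (linked? a b) (link a b ∷ es))}
      {_ : Answer red a b pos r n} {_ : Answer blue a b pos r n} →
      OnJust (join a b ps) (λ j → Wins (position m (proj₁ j) (link a b ∷ es)) r n) → Wins pos r (suc n)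
    force a b {a≢b} {l} {kr} {kb} kg = connect a b {a≢b} {l} kg kr kb

  finish : ∀ {m a b es n} {_ : True (¬? (a ≟ b))} {_ : True (Any.any? (linked? a b) (link a b ∷ es))}
     {_ : Answer red a b (position m (seg a b ∷ []) es) 0 n} {_ : Answer blue a b (position m (seg a b ∷ []) es) 0 n} →
     Wins (position m (seg a b ∷ []) es) 0 (suc n)
  finish {m} {a} {b} {es} {n} {a≢b} {l} {kr} {kb} = draw a b {a≢b} (closed {m} {a} {b} {link a b ∷ es} {n} {l}) kr kb

  -- Positions with a saturated end.

  -- The letters give the types of the ends of the green paths (a lone letter after + being a single vertex):
  -- F is free, R (B) has a red (blue) edge, S has both. In SS+R the single vertex may be a neighbour of end 0 only.
  SS SS+R+R SS+S SS+R SR SF SR+R FR+SS RR+SS : Position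
  SS = position 2 (seg 0 1 ∷ [])
    (half red 0 (1 ∷ []) ∷ half blue 0 (1 ∷ []) ∷ half red 1 (0 ∷ []) ∷ half blue 1 (0 ∷ []) ∷ [])
  SS+R+R = position 4 (one 3 ∷ one 2 ∷ seg 0 1 ∷ [])
    (half red 2 (3 ∷ []) ∷ half red 3 (2 ∷ []) ∷ half red 0 (1 ∷ []) ∷ half blue 0 (1 ∷ []) ∷ half red 1 (0 ∷ []) ∷
     half blue 1 (0 ∷ []) ∷ [])
  SS+S = position 3 (one 2 ∷ seg 0 1 ∷ [])
    (half red 2 [] ∷ half blue 2 [] ∷ half red 0 (1 ∷ []) ∷ half blue 0 (1 ∷ []) ∷ half red 1 (0 ∷ []) ∷
     half blue 1 (0 ∷ []) ∷ [])
  SS+R = position 3 (one 2 ∷ seg 0 1 ∷ [])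
    (half red 0 (1 ∷ 2 ∷ []) ∷ half blue 0 (1 ∷ 2 ∷ []) ∷ half red 1 (0 ∷ []) ∷ half blue 1 (0 ∷ []) ∷
     half red 2 (0 ∷ []) ∷ [])
  SR = position 2 (seg 0 1 ∷ [])
    (half red 0 (1 ∷ []) ∷ half blue 0 (1 ∷ []) ∷ half red 1 (0 ∷ []) ∷ [])
  SF = position 2 (seg 0 1 ∷ [])
    (half red 0 [] ∷ half blue 0 [] ∷ [])
  SR+R = position 3 (one 2 ∷ seg 0 1 ∷ [])
    (half red 0 (1 ∷ []) ∷ half blue 0 (1 ∷ []) ∷ half red 1 (0 ∷ 2 ∷ []) ∷ half red 2 (1 ∷ []) ∷ [])
  FR+SS = position 4 (seg 0 1 ∷ seg 2 3 ∷ [])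
    (half red 1 (2 ∷ []) ∷ half red 2 (1 ∷ 3 ∷ []) ∷ half blue 2 (1 ∷ 3 ∷ []) ∷ half red 3 (2 ∷ []) ∷
     half blue 3 (2 ∷ []) ∷ [])
  RR+SS = position 4 (seg 0 1 ∷ seg 2 3 ∷ [])
    (half red 0 (1 ∷ []) ∷ half red 1 (0 ∷ []) ∷ half red 2 (3 ∷ []) ∷ half blue 2 (3 ∷ []) ∷ half red 3 (2 ∷ []) ∷
     half blue 3 (2 ∷ []) ∷ [])

  SS-1 : ∀ {n} → 2 ≤ n → Wins SS 1 n
  SS-1 (s≤s (s≤s _)) = new (force 1 2 finish)

  SS+S-2 : ∀ {n} → 4 ≤ n → Wins SS+S 2 n
  SS+S-2 (s≤s (s≤s (s≤s (s≤s _)))) = new (force 1 3 (force 3 2 (new (force 2 4 finish))))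

  -- With w rounds to spare beyond the r + (number of pieces) green edges that are still needed, the main conditions say
  -- 2w ≥ r, r + 1, r + 2 and r + 1. The excluded cases (r , n) = (3 , 6), (2 , 5) and (1 , 4) satisfy them,
  -- but there the moves below fail; this is why SS+R at (4 , 8) and SR+R at (2 , 6) and (5 , 10) are treated separately.
  record Safe (n : ℕ) : Set where
    field
      SS+R-wins : ∀ r → 4 + r * 3 ≤ n * 2 → Wins SS+R r n
      SR-wins : ∀ r → 3 + suc r * 3 ≤ n * 2 → (suc r ≡ 3 → 7 ≤ n) → Wins SR (suc r) n
      SF-wins : ∀ r → 4 + r * 3 ≤ n * 2 → (r ≡ 2 → 6 ≤ n) → Wins SF r n
      SR+R-wins : ∀ r → 5 + r * 3 ≤ n * 2 → (r ≡ 1 → 5 ≤ n) → Wins SR+R r n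
  open Safe

  -- Four green edges are needed, so one wasted edge is affordable. If the edge 04 is blue, 0 is
  -- saturated and the blue edge at 4 forces 4 onto the red end 1.
  RR+SS-wins : (∀ {n} → n < 5 → Safe n) → Wins RR+SS 2 5
  RR+SS-wins ih = new (connect 0 4
    (force 3 4 (use SR false (2 ∷ 1 ∷ []) (SR-wins (ih (earlier 1)) 0 ≤-refl λ ())))
    tt
    (force 3 4 (force 4 1 (new (force 0 5 finish)))))

  FR+SS-wins : (∀ {n} → n < 7 → Safe n) → Wins FR+SS 3 7
  FR+SS-wins ih = new (connect 0 4
    (force 3 4 (use SR false (2 ∷ 1 ∷ []) (SR-wins (ih (earlier 1)) 1 (n≤1+n _) λ ())))
    (connect 4 1
      (use RR+SS false (0 ∷ 4 ∷ 2 ∷ 3 ∷ []) (RR+SS-wins λ l → ih (≤-trans l (m≤n+m _ 2))))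
      tt
      (force 2 0 (new (force 1 5 (force 5 4 (new (force 4 6 finish)))))))
    (force 4 1 (use RR+SS true (0 ∷ 4 ∷ 2 ∷ 3 ∷ []) (RR+SS-wins λ l → ih (≤-trans l (m≤n+m _ 2))))))

  SS+R+R-wins : (∀ {n} → n < 6 → Safe n) → Wins SS+R+R 1 5
  SS+R+R-wins ih = new (connect 3 4
    (force 0 4 (use SR false (1 ∷ 3 ∷ []) (SR-wins (ih (earlier 2)) 0 ≤-refl λ ())))
    tt
    (use SS+S false (0 ∷ 1 ∷ 3 ∷ []) (SS+S-2 ≤-refl)))

  SS-3-6 : (∀ {n} → n < 6 → Safe n) → Wins SS 3 6
  SS-3-6 ih = new (new (connect 2 3
    (force 0 2 (use SF false (1 ∷ 3 ∷ []) (SF-wins (ih (earlier 1)) 1 (n≤1+n _) λ ())))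
    (use SS+R+R false (0 ∷ 1 ∷ 2 ∷ 3 ∷ []) (SS+R+R-wins ih))
    (use SS+R+R true (0 ∷ 1 ∷ 2 ∷ 3 ∷ []) (SS+R+R-wins ih))))

  -- Extending the half-used end either grows the path (`SF`) or saturates that end and leaves a
  -- half-used vertex (`SS+R`). The excluded cases form a chain: `SR` at (3 , 6) leads to `SF` at (2
  -- , 5), and that to `SR+R` at (1 , 4).
  SR-step : ∀ n → (∀ {m} → m < n → Safe m) → ∀ r → 3 + suc r * 3 ≤ n * 2 → (suc r ≡ 3 → 7 ≤ n) → Wins SR (suc r) n
  SR-step n ih r h h₃ with n , refl ← unroll (atLeast 1 n (s≤s h)) = new (connect 1 2
    (use SF false (0 ∷ 2 ∷ []) (SF-wins (ih (earlier 0)) r (cancel 2 0 h) λ eq → s≤s⁻¹ (h₃ (cong suc eq))))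
    tt
    (use SS+R true (1 ∷ 0 ∷ 2 ∷ []) (SS+R-wins (ih (earlier 0)) r (cancel 2 0 h))))

  SF-step : ∀ n → (∀ {m} → m < n → Safe m) → ∀ r → 4 + r * 3 ≤ n * 2 → (r ≡ 2 → 6 ≤ n) → Wins SF r n
  SF-step n ih zero h _ with n , refl ← unroll (atLeast 1 n (s≤s h)) = finish
  SF-step n ih (suc r) h h₂ with n , refl ← unroll (atLeast 1 n (s≤s h)) = new (connect 1 2
    -- For `r` = 2 the bound is 13 ≤ 2(n + 1), hence n ≥ 6: a green answer never leads to (2 , 5).
    (use SF false (0 ∷ 2 ∷ []) (SF-wins (ih (earlier 0)) r (cancel 2 1 h) λ { refl → atLeast 6 _ (s≤s (cancel 2 0 h)) }))
    (use SR+R false (0 ∷ 1 ∷ 2 ∷ []) (SR+R-wins (ih (earlier 0)) r (cancel 2 0 h) λ { refl → s≤s⁻¹ (h₂ refl) }))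
    (use SR+R true (0 ∷ 1 ∷ 2 ∷ []) (SR+R-wins (ih (earlier 0)) r (cancel 2 0 h) λ { refl → s≤s⁻¹ (h₂ refl) })))

  -- This is the basic exchange: a blue answer saturates 2, a new vertex joins it to end 1, and
  -- `SS+R` recurs with colours exchanged, two vertices gained in three rounds. The green reply is a
  -- parameter because the tight case needs another continuation.
  SS+R-main : ∀ n → (∀ {m} → m < 3 + n → Safe m) → ∀ r → 4 + r * 3 ≤ n * 2 →
    Wins (position 4 (seg 2 3 ∷ seg 0 1 ∷ []) (link 2 3 ∷ facts SS+R)) (suc r) (2 + n) → Wins SS+R (2 + r) (3 + n)
  SS+R-main n ih r h green-wins = new (connect 2 3 green-wins tt
    (new (force 1 4 (force 4 2 (use SS+R true (2 ∷ 0 ∷ 3 ∷ []) (SS+R-wins (ih (earlier 2)) r h))))))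

  SS+R-step : ∀ n → (∀ {m} → m < n → Safe m) → ∀ r → 4 + r * 3 ≤ n * 2 → Wins SS+R r n
  SS+R-step n ih 0 h = use SS false (0 ∷ 1 ∷ []) (SS-1 (atLeast 2 n (s≤s h)))
  SS+R-step n ih 1 h with n , refl ← unroll (atLeast 4 n (s≤s h)) =
    -- End 0 may already be the red neighbour of 2, so 2 is attached to end 1.
    force 1 2 (use SR false (0 ∷ 2 ∷ []) (SR-wins (ih (earlier 0)) 0 (m≤m+n _ _) λ ()))
  SS+R-step n ih (suc (suc r)) h with n′ , refl ← unroll (atLeast 3 n (s≤s (≤-trans (m≤m+n 10 (r * 3)) h))) with 6 ≤? n′
  ... | yes 6≤n = SS+R-main n′ ih r (cancel 6 0 h) (force 1 3 (use SR false (0 ∷ 2 ∷ []) (SR-wins (ih (earlier 1)) r (cancel 4 0 h) λ _ → s≤s 6≤n)))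
  ... | no 6≰n with r ≟ 2
  ...   | no r≢2 = SS+R-main n′ ih r (cancel 6 0 h) (force 1 3 (use SR false (0 ∷ 2 ∷ []) (SR-wins (ih (earlier 1)) r (cancel 4 0 h) λ eq → ⊥-elim (r≢2 (suc-injective eq)))))
  ...   | yes refl with refl ← ≤-antisym (s≤s⁻¹ (≰⇒> 6≰n)) (atLeast 5 n′ (s≤s (cancel 6 0 h))) =
    -- Joining 3 to end 1 here would reach `SR` at the excluded (3 , 6), so the two paths are kept
    -- apart.
    SS+R-main 5 ih 2 ≤-refl (use FR+SS false (3 ∷ 2 ∷ 0 ∷ 1 ∷ []) (FR+SS-wins λ l → ih (≤-trans l (n≤1+n 7))))

  -- Every line absorbs 2 and the new vertices 3 and 4 with three green edges: without waste it ends
  -- in `SF`, with one wasted edge in `SR`.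
  SR+R-main : ∀ n → (∀ {m} → m < 4 + n → Safe m) → ∀ r → 3 + suc r * 3 ≤ n * 2 → (suc r ≡ 3 → 7 ≤ n) → (suc r ≡ 2 → 5 ≤ n) → Wins SR+R (3 + r) (4 + n)
  SR+R-main n ih r h h₃ h₂ = new (connect 2 3
    (new (connect 1 4
      (connect 4 2
        (use SF false (0 ∷ 3 ∷ []) (SF-wins (ih (earlier 2)) (suc r) (s≤s (≤-trans h (n≤1+n _))) λ eq → s≤s (h₂ eq)))
        tt
        (force 0 3 (use SR true (2 ∷ 4 ∷ []) (SR-wins (ih (earlier 3)) r h h₃))))
      tt
      (force 2 4 (force 0 3 (use SR true (1 ∷ 4 ∷ []) (SR-wins (ih (earlier 3)) r h h₃))))))
    tt
    (force 1 3 (new (force 0 4 (force 4 2 (use SR true (2 ∷ 3 ∷ []) (SR-wins (ih (earlier 3)) r h h₃)))))))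

  SR+R-2-6 : (∀ {n} → n < 6 → Safe n) → Wins SR+R 2 6
  SR+R-2-6 ih = new (connect 2 3
    (connect 3 1
      (use SR false (0 ∷ 2 ∷ []) (SR-wins (ih (earlier 1)) 0 (m≤m+n _ _) λ ()))
      tt
      (force 0 2 (use SR true (1 ∷ 3 ∷ []) (SR-wins (ih (earlier 2)) 0 ≤-refl λ ()))))
    tt
    (force 1 3 (force 0 2 (use SR true (2 ∷ 3 ∷ []) (SR-wins (ih (earlier 2)) 0 ≤-refl λ ())))))

  -- The lines of `SR+R-main` would reach `SR` at (3 , 6). The replacements pass through `FR+SS` at
  -- (3 , 7), `SS` at (3 , 6), or explicit endgames.
  SR+R-5-10 : (∀ {n} → n < 10 → Safe n) → Wins SR+R 5 10
  SR+R-5-10 ih = new (connect 2 3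
    (new (connect 1 4
      (connect 4 2
        (use SF false (0 ∷ 3 ∷ []) (SF-wins (ih (earlier 2)) 3 (n≤1+n _) λ ()))
        tt
        (new (connect 3 5
          (force 0 5 (use SR true (2 ∷ 4 ∷ []) (SR-wins (ih (earlier 4)) 1 (n≤1+n _) λ ())))
          (force 3 4 (use SS+R false (2 ∷ 0 ∷ 5 ∷ []) (SS+R-wins (ih (earlier 4)) 2 ≤-refl)))
          (connect 5 4
            (new (connect 3 6
              (force 0 6 (use SR true (2 ∷ 5 ∷ []) (SR-wins (ih (earlier 6)) 0 ≤-refl λ ())))
              (force 6 5 (force 2 6 (new (force 0 7 finish))))
              tt))
            (force 0 3 (new (force 2 6 (force 6 5 (new (force 5 7 finish))))))
            tt))))
      tt
      (force 2 4 (use FR+SS true (3 ∷ 4 ∷ 1 ∷ 0 ∷ []) (FR+SS-wins λ l → ih (≤-trans l (m≤n+m _ 3)))))))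
    tt
    (new (connect 3 4
      (force 3 1 (force 2 4 (use SS false (2 ∷ 0 ∷ []) (SS-3-6 λ l → ih (≤-trans l (m≤n+m _ 4))))))
      (force 3 1 (new (force 0 5 (force 5 2 (use SS+R false (3 ∷ 2 ∷ 4 ∷ []) (SS+R-wins (ih (earlier 4)) 2 ≤-refl))))))
      tt)))

  SR+R-step : ∀ n → (∀ {m} → m < n → Safe m) → ∀ r → 5 + r * 3 ≤ n * 2 → (r ≡ 1 → 5 ≤ n) → Wins SR+R r n
  SR+R-step n ih 0 h h₁ = use SR false (0 ∷ 1 ∷ []) (SR-step n ih 0 (double (atLeast 3 n (s≤s h))) λ ())
  SR+R-step n ih 1 h h₁ = use SR false (0 ∷ 1 ∷ []) (SR-step n ih 1 (≤-trans (n≤1+n _) (double (h₁ refl))) λ ())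
  SR+R-step n ih 2 h h₁ with 7 ≤? n
  ... | yes 7≤n = use SR false (0 ∷ 1 ∷ []) (SR-step n ih 2 (≤-trans (m≤n+m _ 2) (double 7≤n)) λ _ → 7≤n)
  ... | no 7≰n with refl ← ≤-antisym (s≤s⁻¹ (≰⇒> 7≰n)) (atLeast 6 n (s≤s h)) = SR+R-2-6 ih
  SR+R-step n ih (suc (suc (suc r))) h h₁ with n′ , refl ← unroll (atLeast 4 n (≤-trans (m≤m+n 14 _) (≤-trans h (n≤1+n _)))) with r ≟ 2
  ... | no r≢2 = SR+R-main n′ ih r (cancel 8 0 h) (λ eq → ⊥-elim (r≢2 (suc-injective eq))) λ { refl → atLeast 5 n′ (s≤s (cancel 8 0 h)) }
  ... | yes refl with 7 ≤? n′
  ...   | yes 7≤n = SR+R-main n′ ih r (cancel 8 0 h) (λ _ → 7≤n) λ ()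
  ...   | no 7≰n with refl ← ≤-antisym (s≤s⁻¹ (≰⇒> 7≰n)) (atLeast 6 n′ (s≤s (cancel 8 0 h))) = SR+R-5-10 ih

  safe : ∀ n → Safe n
  safe = <-rec Safe λ n ih → record { SS+R-wins = SS+R-step n ih ; SR-wins = SR-step n ih ; SF-wins = SF-step n ih ; SR+R-wins = SR+R-step n ih }

  -- Positions without a saturated end.

  FR RR RB RR+R BR+B FR+R FF R+R : Position
  FF = position 2 (seg 0 1 ∷ []) []
  FR = position 2 (seg 0 1 ∷ [])
    (half red 1 [] ∷ [])
  RR = position 2 (seg 0 1 ∷ [])
    (half red 0 (1 ∷ []) ∷ half red 1 (0 ∷ []) ∷ [])
  RB = position 2 (seg 0 1 ∷ [])
    (half red 0 (1 ∷ []) ∷ half blue 1 (0 ∷ []) ∷ [])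
  RR+R = position 3 (one 2 ∷ seg 0 1 ∷ [])
    (half red 0 (2 ∷ []) ∷ half red 1 [] ∷ half red 2 (0 ∷ []) ∷ [])
  BR+B = position 3 (one 2 ∷ seg 0 1 ∷ [])
    (half blue 0 (2 ∷ []) ∷ half red 1 [] ∷ half blue 2 (0 ∷ []) ∷ [])
  FR+R = position 3 (one 2 ∷ seg 0 1 ∷ [])
    (half red 1 (2 ∷ []) ∷ half red 2 (1 ∷ []) ∷ [])
  R+R = position 2 (one 1 ∷ one 0 ∷ [])
    (half red 0 (1 ∷ []) ∷ half red 1 (0 ∷ []) ∷ [])

  -- Until some end is saturated, Painter can delay by answering green. In terms of w the first condition is
  -- 3w ≥ r + 12: each further red or blue edge costs Painter three green vertices before FR recurs, and
  -- five spare rounds remain for the last missing vertex. The second, 2w ≥ r + 3, pays for the moves to a safe position.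
  FRWins : ℕ → Set
  FRWins n = ∀ r → 15 + suc r * 4 ≤ n * 3 → 5 + suc r * 3 ≤ n * 2 → Wins FR (suc r) n

  -- For the last vertex the first green edge is not merged: if Painter refuses to close the cycle through the
  -- new vertex, that vertex is given up and end 1 has become saturated.
  RR-wins : ∀ n → (∀ {m} → m < n → FRWins m) → ∀ r → 14 + suc r * 4 ≤ n * 3 → 5 + suc r * 3 ≤ n * 2 → Wins RR (suc r) n
  RR-wins n ih zero h₃ h₂ with n , refl ← unroll (atLeast³ 6 n (m≤n⇒m≤1+n (m≤n⇒m≤1+n h₃))) = new (draw 0 2
    (draw 2 1 (merge 0 2 closed) tt
      (use SR false (1 ∷ 0 ∷ []) (SR-wins (safe _) 0 (m≤m+n _ _) λ ())))
    tt
    (use SR false (0 ∷ 1 ∷ []) (SR-wins (safe _) 0 (m≤m+n _ _) λ ())))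
  RR-wins n ih (suc r) h₃ h₂ with n , refl ← unroll (atLeast 1 n (s≤s h₂)) = new (connect 1 2
    (use FR false (2 ∷ 0 ∷ []) (ih (earlier 0) r (cancel 3 0 h₃) (cancel 2 1 h₂)))
    tt
    (use SR false (1 ∷ 0 ∷ []) (SR-wins (safe _) (suc r) (cancel 2 0 h₂) λ { refl → atLeast³ 7 _ (m≤n⇒m≤1+n (m≤n⇒m≤1+n (cancel 3 2 h₃))) })))

  RB-wins : ∀ n → (∀ {m} → m < n → FRWins m) → ∀ r → 14 + suc r * 4 ≤ n * 3 → 5 + suc r * 3 ≤ n * 2 → Wins RB (suc r) n
  RB-wins n ih zero h₃ h₂ with n , refl ← unroll (atLeast³ 6 n (m≤n⇒m≤1+n (m≤n⇒m≤1+n h₃))) = new (draw 0 2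
    (draw 2 1 (merge 0 2 closed)
      (use SR false (1 ∷ 0 ∷ []) (SR-wins (safe _) 0 (m≤m+n _ _) λ ()))
      tt)
    tt
    (use SR true (0 ∷ 1 ∷ []) (SR-wins (safe _) 0 (m≤m+n _ _) λ ())))
  RB-wins n ih (suc r) h₃ h₂ with n , refl ← unroll (atLeast 1 n (s≤s h₂)) = new (connect 1 2
    (use FR false (2 ∷ 0 ∷ []) (ih (earlier 0) r (cancel 3 0 h₃) (cancel 2 1 h₂)))
    (use SR false (1 ∷ 0 ∷ []) (SR-wins (safe _) (suc r) (cancel 2 0 h₂) λ { refl → atLeast³ 7 _ (m≤n⇒m≤1+n (m≤n⇒m≤1+n (cancel 3 2 h₃))) }))
    tt)

  -- Ends 0 and 2 may share their red edge, so 2 is attached to end 1 or through a new vertex. For r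
  -- ≥ 2 a blue answer saturates one vertex and puts a blue edge at 3, which is then forced onto the
  -- red end 0.
  RR+R-wins : ∀ n → (∀ {m} → m < n → FRWins m) → ∀ r → 16 + r * 4 ≤ n * 3 → 6 + r * 3 ≤ n * 2 → Wins RR+R r n
  RR+R-wins n ih 0 h₃ h₂ = use RR false (0 ∷ 1 ∷ []) (RR-wins n ih 0 (triple (atLeast³ 6 n (+-monoʳ-≤ 2 h₃))) (≤-trans (m≤n+m 8 4) (double (atLeast³ 6 n (+-monoʳ-≤ 2 h₃)))))
  RR+R-wins n ih 1 h₃ h₂ with n , refl ← unroll (atLeast³ 7 n (m≤n⇒m≤1+n (s≤s h₃))) = connect 2 1
    (use RR false (0 ∷ 2 ∷ []) (RR-wins (6 + n) (λ l → ih (m≤n⇒m≤1+n l)) 0 (m≤m+n _ _) (m≤m+n _ _)))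
    tt
    (use SR false (1 ∷ 0 ∷ []) (SR-wins (safe _) 1 (m≤m+n _ _) λ ()))
  RR+R-wins n ih (suc (suc r)) h₃ h₂ with n , refl ← unroll (atLeast 3 n (s≤s (≤-trans (m≤m+n 12 _) h₂))) = new (connect 2 3
    (connect 3 1
      (use RR false (2 ∷ 0 ∷ []) (RR-wins (suc n) (λ l → ih (m≤n⇒m≤1+n (m≤n⇒m≤1+n l))) r (cancel 6 0 h₃) (cancel 4 0 h₂)))
      tt
      (force 3 0 (use SR false (1 ∷ 2 ∷ []) (SR-wins (safe _) r (cancel 6 0 h₂) big))))
    tt
    (force 0 3 (force 2 1 (use SR true (2 ∷ 3 ∷ []) (SR-wins (safe _) r (cancel 6 0 h₂) big)))))
    where
    big : suc r ≡ 3 → 7 ≤ n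
    big refl = atLeast³ 7 n (m≤n⇒m≤1+n (m≤n⇒m≤1+n (cancel 9 2 h₃)))

  BR+B-wins : ∀ n → (∀ {m} → m < n → FRWins m) → ∀ r → 16 + r * 4 ≤ n * 3 → 6 + r * 3 ≤ n * 2 → Wins BR+B r n
  BR+B-wins n ih 0 h₃ h₂ = use RB true (0 ∷ 1 ∷ []) (RB-wins n ih 0 (triple (atLeast³ 6 n (+-monoʳ-≤ 2 h₃))) (≤-trans (m≤n+m 8 4) (double (atLeast³ 6 n (+-monoʳ-≤ 2 h₃)))))
  BR+B-wins n ih 1 h₃ h₂ with n , refl ← unroll (atLeast³ 7 n (m≤n⇒m≤1+n (s≤s h₃))) = force 2 1
    (use RR true (0 ∷ 2 ∷ []) (RR-wins (6 + n) (λ l → ih (m≤n⇒m≤1+n l)) 0 (m≤m+n _ _) (m≤m+n _ _)))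
  BR+B-wins n ih (suc (suc r)) h₃ h₂ with n , refl ← unroll (atLeast 3 n (s≤s (≤-trans (m≤m+n 12 _) h₂))) = new (connect 2 3
    (connect 3 0
      (use RB true (2 ∷ 1 ∷ []) (RB-wins (suc n) (λ l → ih (m≤n⇒m≤1+n (m≤n⇒m≤1+n l))) r (cancel 6 0 h₃) (cancel 4 0 h₂)))
      (force 2 1 (use SR false (0 ∷ 3 ∷ []) (SR-wins (safe _) r (cancel 6 0 h₂) big)))
      tt)
    (force 0 3 (force 2 1 (use SR false (2 ∷ 3 ∷ []) (SR-wins (safe _) r (cancel 6 0 h₂) big))))
    tt)
    where
    big : suc r ≡ 3 → 7 ≤ n
    big refl = atLeast³ 7 n (m≤n⇒m≤1+n (m≤n⇒m≤1+n (cancel 9 2 h₃)))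

  -- The free end is played: a green answer keeps w and lowers r, so both conditions become slacker,
  -- while any other answer leaves both ends half-used.
  FR-wins : ∀ n → FRWins n
  FR-wins = <-rec FRWins step
    where
    step : ∀ n → (∀ {m} → m < n → FRWins m) → FRWins n
    step n ih zero h₃ h₂ with n , refl ← unroll (atLeast³ 7 n (+-monoʳ-≤ 2 h₃)) = new (draw 0 2
      (draw 2 1 (merge 0 2 closed) tt
        (use SF false (1 ∷ 0 ∷ []) (SF-wins (safe _) 1 (m≤m+n _ _) λ ())))
      (use RR+R false (0 ∷ 1 ∷ 2 ∷ []) (RR+R-wins _ (λ l → ih (m≤n⇒m≤1+n l)) 0 (m≤m+n _ _) (m≤m+n _ _)))
      (use BR+B false (0 ∷ 1 ∷ 2 ∷ []) (BR+B-wins _ (λ l → ih (m≤n⇒m≤1+n l)) 0 (m≤m+n _ _) (m≤m+n _ _))))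
    step n ih (suc r) h₃ h₂ with n , refl ← unroll (atLeast 1 n (s≤s h₂)) = new (connect 0 2
      (use FR false (2 ∷ 1 ∷ []) (ih (earlier 0) r (cancel 3 1 h₃) (cancel 2 1 h₂)))
      (use RR+R false (0 ∷ 1 ∷ 2 ∷ []) (RR+R-wins n (λ l → ih (m≤n⇒m≤1+n l)) (suc r) (cancel 3 0 h₃) (cancel 2 0 h₂)))
      (use BR+B false (0 ∷ 1 ∷ 2 ∷ []) (BR+B-wins n (λ l → ih (m≤n⇒m≤1+n l)) (suc r) (cancel 3 0 h₃) (cancel 2 0 h₂))))

  -- The third bound says w ≥ 6. It serves small `r`, where the other two are too weak to reach
  -- `FR`.
  FR+R-wins : ∀ n r → 17 + r * 4 ≤ n * 3 → 7 + r * 3 ≤ n * 2 → 8 + r ≤ n → Wins FR+R r n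
  FR+R-wins n 0 h₃ h₂ h₁ with n , refl ← unroll h₁ = use FR false (0 ∷ 1 ∷ []) (FR-wins _ 0 (m≤m+n _ _) (m≤m+n _ _))
  FR+R-wins n 1 h₃ h₂ h₁ with n , refl ← unroll h₁ = use FR false (0 ∷ 1 ∷ []) (FR-wins _ 1 (m≤m+n _ _) (m≤m+n _ _))
  FR+R-wins n (suc (suc r)) h₃ h₂ h₁ with n , refl ← unroll (≤-trans (m≤m+n 4 _) h₁) = connect 0 2
    (use RR false (1 ∷ 2 ∷ []) (RR-wins _ (λ _ → FR-wins _) (suc r) (cancel 3 0 h₃) (cancel 2 0 h₂)))
    tt
    (new (connect 1 3
      (force 2 3 (use SR true (2 ∷ 0 ∷ []) (SR-wins (safe _) r (cancel 6 1 h₂) λ { refl → ≤-trans (m≤m+n 7 _) (cancel 3 0 h₁) })))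
      tt
      (new (force 1 4 (force 4 2 (use SR+R true (2 ∷ 0 ∷ 3 ∷ []) (SR+R-wins (safe _) r (cancel 8 0 h₂) λ { refl → ≤-trans (m≤m+n 5 _) (cancel 4 0 h₁) })))))))

  FF-wins : ∀ n r → 16 + suc r * 4 ≤ n * 3 → 6 + suc r * 3 ≤ n * 2 → 8 + suc r ≤ n → Wins FF (suc r) n
  FF-wins n zero h₃ h₂ h₁ with n , refl ← unroll h₁ = new (draw 1 2
    (draw 2 0 (merge 1 2 closed)
      (use FR false (1 ∷ 0 ∷ []) (FR-wins _ 0 (m≤m+n _ _) (m≤m+n _ _)))
      (use FR true (1 ∷ 0 ∷ []) (FR-wins _ 0 (m≤m+n _ _) (m≤m+n _ _))))
    (use FR+R false (0 ∷ 1 ∷ 2 ∷ []) (FR+R-wins _ 0 (m≤m+n _ _) (m≤m+n _ _) (m≤m+n _ _)))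
    (use FR+R true (0 ∷ 1 ∷ 2 ∷ []) (FR+R-wins _ 0 (m≤m+n _ _) (m≤m+n _ _) (m≤m+n _ _))))
  FF-wins (suc n) (suc r) h₃ h₂ h₁ = new (connect 1 2
    (use FF false (0 ∷ 2 ∷ []) (FF-wins n r (cancel 3 1 h₃) (cancel 2 1 h₂) (cancel 1 0 h₁)))
    (use FR+R false (0 ∷ 1 ∷ 2 ∷ []) (FR+R-wins n (suc r) (cancel 3 0 h₃) (cancel 2 0 h₂) (cancel 1 0 h₁)))
    (use FR+R true (0 ∷ 1 ∷ 2 ∷ []) (FR+R-wins n (suc r) (cancel 3 0 h₃) (cancel 2 0 h₂) (cancel 1 0 h₁))))

  -- The opening moves.

  R+R-wins : ∀ j → Wins R+R (14 + j * 4) (24 + j * 6)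
  R+R-wins j = new (connect 1 2
    -- The first bound reads 69 + 16j ≤ 69 + 18j: it is tight at k = 4 and would fail at k = 3. The
    -- second is an equality for all j.
    (use FR+R false (2 ∷ 1 ∷ 0 ∷ []) (FR+R-wins _ (13 + j * 4) (+-monoʳ-≤ 69 (16j≤18j j)) (+-monoʳ-≤ 46 (12j≤12j j)) (+-mono-≤ (m≤m+n 21 2) (4j≤6j j))))
    tt
    (new (connect 0 3
      (force 1 3 (use SR false (1 ∷ 0 ∷ []) (SR-wins (safe _) (12 + j * 4) (+-monoʳ-≤ 42 (12j≤12j j)) λ ())))
      tt
      -- Vertex 2 is given up. Both sides of the bound for `SS+R` are 40 + 12j, so this line has no
      -- slack for any k.
      (new (force 1 4 (force 4 0 (use SS+R true (0 ∷ 1 ∷ 3 ∷ []) (SS+R-wins (safe _) (12 + j * 4) (+-monoʳ-≤ 40 (12j≤12j j))))))))))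

  start-wins : ∀ j → Wins (position 0 [] []) (16 + j * 4) (25 + j * 6)
  start-wins j = new (new (connect 0 1
    (use FF false (0 ∷ 1 ∷ []) (FF-wins _ (13 + j * 4) (+-monoʳ-≤ 72 (16j≤18j j)) (+-monoʳ-≤ 48 (12j≤12j j)) (+-mono-≤ (m≤m+n 22 2) (4j≤6j j))))
    (use R+R false (0 ∷ 1 ∷ []) (R+R-wins j))
    (use R+R true (0 ∷ 1 ∷ []) (R+R-wins j))))

theorem4p11 : (k : ℕ) → 4 ≤ k →
    OnlineRamseyLE (P 3) (P 3) (C (4 * k)) (6 * k + 1)
theorem4p11 k 4≤k with j , refl ← unroll 4≤k =
  subst₂ (λ l n → OnlineRamseyLE (P 3) (P 3) (C l) n) (sym (length-eq j)) (sym (rounds-eq j))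
    (Strategy.Wins.run (Strategy.start-wins _ j) {s = false} (Strategy.realised id [] (placed [] [] (λ _ _ ()) refl)))
  where
  length-eq : ∀ j → 4 * (4 + j) ≡ 16 + j * 4
  length-eq = solve-∀
  rounds-eq : ∀ j → 6 * (4 + j) + 1 ≡ 25 + j * 6
  rounds-eq = solve-∀
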